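{- Let $q$ be a prime power, $n\ge1$ and $r\ge1$. Suppose there exists a partial $(r-1)$-spread of $\mathrm{PG}(n-1,q^2)$ of size $N$. Then there exists a constant rank-distance $k=2r$ set in $H_n(\mathbb{F}_{q^2})$ of size $N$.
   Context: A partial $(r-1)$-spread of $\mathrm{PG}(n-1,q^2)$ is a set of pairwise disjoint $(r-1)$-dimensional projective subspaces (i.e. $r$-dimensional vector subspaces of $\mathbb{F}_{q^2}^n$ pairwise intersecting trivially). $H_n(\mathbb{F}_{q^2})$ is the set of $n\times n$ hermitian matrices over $\mathbb{F}_{q^2}$ (matrices $A$ with $\overline{A}^T=A$, $\overline{\cdot}$ being $x\mapsto x^q$ entrywise). A constant rank-distance $k$ set is a set $U$ of $n\times n$ matrices with $\mathrm{rank}(A-B)=k$ for all distinct $A,B\in U$ and $\mathrm{rank}(A)=k$ for all nonzero $A\in U$. -}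

module Defs where

open import Level using (0ℓ)
open import Data.Nat using (ℕ; zero; suc; _≤_)
open import Data.Nat.Primality using (Prime)
open import Data.Fin using (Fin; zero; suc)
open import Data.Product using (Σ; ∃; _×_; _,_)
open import Relation.Nullary using (¬_)
open import Relation.Binary.PropositionalEquality using (_≡_; _≢_)
open import Algebra.Structures using (IsCommutativeRing)

IsPrimePower : ℕ → Set
IsPrimePower q = Σ ℕ λ p → Σ ℕ λ m → Prime p × (1 ≤ m) × (q ≡ p Data.Nat.^ m)

record Field : Set₁ where
  infixl 7 _*_
  infixl 6 _+_
  field
    Carrier : Set
    _+_ _*_ : Carrier → Carrier → Carrier
    -_      : Carrier → Carrier
    0# 1#   : Carrier
    isCommutativeRing : IsCommutativeRing _≡_ _+_ _*_ -_ 0# 1#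
    0≢1     : 0# ≢ 1#
    inverse : ∀ x → x ≢ 0# → Σ Carrier λ y → x * y ≡ 1#

  _-_ : Carrier → Carrier → Carrier
  x - y = x + (- y)

  _^_ : Carrier → ℕ → Carrier
  x ^ zero = 1#
  x ^ suc m = x * (x ^ m)

module LinAlg (K : Field) where
  open Field K

  Vector : ℕ → Set
  Vector n = Fin n → Carrier

  Matrix : ℕ → ℕ → Set
  Matrix m n = Fin m → Fin n → Carrier

  zeroV : ∀ {n} → Vector n
  zeroV _ = 0#

  _≈V_ : ∀ {n} → Vector n → Vector n → Set
  u ≈V v = ∀ i → u i ≡ v i

  _≈M_ : ∀ {m n} → Matrix m n → Matrix m n → Set
  A ≈M B = ∀ i j → A i j ≡ B i j

  _+V_ : ∀ {n} → Vector n → Vector n → Vector n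
  (u +V v) i = u i + v i

  _·V_ : ∀ {n} → Carrier → Vector n → Vector n
  (c ·V v) i = c * v i

  lincomb : ∀ {m n} → (Fin m → Carrier) → (Fin m → Vector n) → Vector n
  lincomb {zero}  c v = zeroV
  lincomb {suc m} c v = (c zero ·V v zero) +V lincomb (λ i → c (suc i)) (λ i → v (suc i))

  LinIndep : ∀ {m n} → (Fin m → Vector n) → Set
  LinIndep {m} {n} v = ∀ (c : Fin m → Carrier) → lincomb c v ≈V zeroV → ∀ i → c i ≡ 0#

  col : ∀ {m n} → Matrix m n → Fin n → Vector m
  col A j i = A i j

  RankIs : ∀ {m n} → Matrix m n → ℕ → Set
  RankIs {m} {n} A k =
    (Σ (Fin k → Fin n) λ s → LinIndep (λ t → col A (s t)))
    × (∀ (s : Fin (suc k) → Fin n) → LinIndep (λ t → col A (s t)) → Data.Empty.⊥)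
    where import Data.Empty

  _-M_ : ∀ {m n} → Matrix m n → Matrix m n → Matrix m n
  (A -M B) i j = A i j - B i j

  zeroM : ∀ {m n} → Matrix m n
  zeroM _ _ = 0#

  IsHermitian : ∀ {n} → ℕ → Matrix n n → Set
  IsHermitian q A = ∀ i j → (A j i) ^ q ≡ A i j

  -- An r-dimensional subspace of K^n, given by a basis (r linearly
  -- independent vectors); v lies in the span iff v = lincomb c b for some c.
  InSpan : ∀ {r n} → (Fin r → Vector n) → Vector n → Set
  InSpan b v = ∃ λ c → lincomb c b ≈V v

  -- partial (r-1)-spread of PG(n-1,K) of size N: N r-dimensional subspaces
  -- of K^n (given by bases) pairwise intersecting trivially
  PartialSpread : (n r N : ℕ) → Set
  PartialSpread n r N =
    Σ (Fin N → Fin r → Vector n) λ S →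
      (∀ i → LinIndep (S i))
      × (∀ i j → i ≢ j → ∀ v → InSpan (S i) v → InSpan (S j) v → v ≈V zeroV)

  ConstRankDistHermitian : (q n k N : ℕ) → Set
  ConstRankDistHermitian q n k N =
    Σ (Fin N → Matrix n n) λ U →
      (∀ i j → U i ≈M U j → i ≡ j)
      × (∀ i → IsHermitian q (U i))
      × (∀ i j → i ≢ j → RankIs (U i -M U j) k)
      × (∀ i → ¬ (U i ≈M zeroM) → RankIs (U i) k)

{-# OPTIONS --safe #-}
module Submission where

-- For a basis v of an r-dimensional subspace W, the sum of the matrices v_t v_t^* over the basis
-- is hermitian with column space W. For trivially intersecting subspaces, the difference of two
-- such matrices H_i - H_j is a product X Z^* whose factors have 2r independent columns, so it has
-- rank 2r. The set of all H_i - H_0 has the same differences, and contains 0 besides matrices of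
-- rank 2r. Conjugation x ↦ x^q is an involutive automorphism because K has characteristic p
-- (Frobenius) and x^(q²) = x (Fermat).

open import Defs
open import Data.Nat using (ℕ; _≤_)
open import Data.Fin using (Fin)
open import Function.Bundles using (_↔_)

open import Algebra.Bundles using (CommutativeMonoid; CommutativeRing)
open import Data.Empty using (⊥-elim)
open import Data.Fin using (zero; suc; inject₁; fromℕ; punchIn; _↑ˡ_; _↑ʳ_; splitAt; join)
open import Data.Fin.Properties using (¬∀⟶∃¬; pigeonhole; join-splitAt)
import Data.Fin.Properties as Fin
open import Data.Nat using (zero; suc; s≤s; z≤n; _!)
import Data.Nat as ℕ
import Data.Nat.Properties as ℕ
open import Data.Nat.Combinatorics using (_C_; nCk≡n!/k![n-k]!; k![n∸k]!∣n!; nCn≡1)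
open import Data.Nat.Divisibility using (_∣_; divides; ∣⇒≤; m∣m*n)
open import Data.Nat.DivMod using (m/n*n≡m)
open import Data.Nat.Primality using (Prime; euclidsLemma; prime⇒nonTrivial)
open import Data.Product using (Σ; _×_; _,_; proj₁; proj₂)
open import Data.Sum using (inj₁; inj₂)
open import Data.Vec.Functional using (_++_)
open import Data.Vec.Functional.Properties using (lookup-++ˡ; lookup-++ʳ)
open import Function using (_∘_)
open import Function.Bundles using (Inverse; mk↔ₛ′)
open import Function.Construct.Composition using (_↔-∘_)
open import Function.Construct.Symmetry using (↔-sym)
open import Function.Properties.Inverse using (↔⇒↣)
open import Level using (0ℓ)
open import Relation.Binary.Definitions using (DecidableEquality)
open import Relation.Binary.PropositionalEquality
open import Relation.Nullary using (¬_; yes; no; contradiction)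
open import Relation.Nullary.Decidable using (decidable-stable; via-injection)

open ≡-Reasoning

-- Field arithmetic and finite sums

module FieldProperties (K : Field) where
  open Field K using (Carrier; _+_; _*_; -_; 0#; 1#; 0≢1; inverse)

  commutativeRing : CommutativeRing 0ℓ 0ℓ
  commutativeRing = record { isCommutativeRing = Field.isCommutativeRing K }

  open CommutativeRing commutativeRing public
    using (+-assoc; +-comm; +-identityˡ; +-identityʳ; -‿inverseˡ; -‿inverseʳ;
           *-assoc; *-comm; *-identityˡ; *-identityʳ; distribˡ; distribʳ; zeroˡ; zeroʳ;
           semiring; ring; +-group; +-abelianGroup; +-commutativeMonoid;
           *-commutativeMonoid; commutativeSemiring)
  open import Algebra.Properties.Semiring.Sum semiring public
    using (sum; sum-syntax; sum-cong-≗; ∑-distrib-+; ∑-comm; *-distribˡ-sum; *-distribʳ-sum;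
           sum-replicate-zero)
  open import Algebra.Properties.Ring ring public using (-1*x≈-x; x+x≈x⇒x≈0)
  open import Algebra.Properties.Group +-group public
    using (inverseʳ-unique) renaming (x∙y⁻¹≈ε⇒x≈y to x-y≡0⇒x≡y)

  *-cancelˡ : ∀ {x y z} → x ≢ 0# → x * y ≡ x * z → y ≡ z
  *-cancelˡ {x} {y} {z} x≢0 xy≡xz = let x⁻¹ , xx⁻¹≡1 = inverse x x≢0 in begin
    y              ≡⟨ *-identityˡ y ⟨
    1# * y         ≡⟨ cong (_* y) (trans (*-comm x⁻¹ x) xx⁻¹≡1) ⟨
    x⁻¹ * x * y    ≡⟨ *-assoc x⁻¹ x y ⟩
    x⁻¹ * (x * y)  ≡⟨ cong (x⁻¹ *_) xy≡xz ⟩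
    x⁻¹ * (x * z)  ≡⟨ *-assoc x⁻¹ x z ⟨
    x⁻¹ * x * z    ≡⟨ cong (_* z) (trans (*-comm x⁻¹ x) xx⁻¹≡1) ⟩
    1# * z         ≡⟨ *-identityˡ z ⟩
    z              ∎

  x*y≡0⇒y≡0 : ∀ {x y} → x ≢ 0# → x * y ≡ 0# → y ≡ 0#
  x*y≡0⇒y≡0 {x} x≢0 xy≡0 = *-cancelˡ x≢0 (trans xy≡0 (sym (zeroʳ x)))

  -1≢0 : - 1# ≢ 0#
  -1≢0 -1≡0 = 0≢1 (begin
    0#         ≡⟨ -‿inverseʳ 1# ⟨
    1# + - 1#  ≡⟨ cong (1# +_) -1≡0 ⟩
    1# + 0#    ≡⟨ +-identityʳ 1# ⟩
    1#         ∎)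

  module _ {n : ℕ} where
    ∑-zero : {f : Fin n → Carrier} → (∀ i → f i ≡ 0#) → sum f ≡ 0#
    ∑-zero f≡0 = trans (sum-cong-≗ f≡0) (sum-replicate-zero n)

    ∑-factorˡ : ∀ a (c y : Fin n → Carrier) →
                ∑[ i < n ] (a * c i * y i) ≡ a * ∑[ i < n ] (c i * y i)
    ∑-factorˡ a c y = begin
      ∑[ i < n ] (a * c i * y i)    ≡⟨ sum-cong-≗ (λ i → *-assoc a (c i) (y i)) ⟩
      ∑[ i < n ] (a * (c i * y i))  ≡⟨ *-distribˡ-sum a (λ i → c i * y i) ⟨
      a * ∑[ i < n ] (c i * y i)    ∎

    ∑-distribʳ : ∀ (c d y : Fin n → Carrier) →
                 ∑[ i < n ] ((c i + d i) * y i) ≡ ∑[ i < n ] (c i * y i) + ∑[ i < n ] (d i * y i)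
    ∑-distribʳ c d y = trans (sum-cong-≗ (λ i → distribʳ (y i) (c i) (d i)))
                             (∑-distrib-+ (λ i → c i * y i) (λ i → d i * y i))

    ∑-distribˡ : ∀ (c x y : Fin n → Carrier) →
                 ∑[ i < n ] (c i * (x i + y i)) ≡ ∑[ i < n ] (c i * x i) + ∑[ i < n ] (c i * y i)
    ∑-distribˡ c x y = trans (sum-cong-≗ (λ i → distribˡ (c i) (x i) (y i)))
                             (∑-distrib-+ (λ i → c i * x i) (λ i → c i * y i))

  -- Associativity c(Xy) = (cX)y for a row vector, a matrix and a column vector, obtained by
  -- exchanging the two sums.
  ∑-assoc : ∀ {m n} (c : Fin m → Carrier) (X : Fin m → Fin n → Carrier) (y : Fin n → Carrier) →
            ∑[ i < m ] (c i * ∑[ t < n ] (X i t * y t)) ≡ ∑[ t < n ] (∑[ i < m ] (c i * X i t) * y t)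
  ∑-assoc {m} {n} c X y = begin
    ∑[ i < m ] (c i * ∑[ t < n ] (X i t * y t))
      ≡⟨ sum-cong-≗ (λ i → ∑-factorˡ (c i) (X i) y) ⟨
    ∑[ i < m ] ∑[ t < n ] (c i * X i t * y t)
      ≡⟨ ∑-comm (λ i t → c i * X i t * y t) ⟩
    ∑[ t < n ] ∑[ i < m ] (c i * X i t * y t)
      ≡⟨ sum-cong-≗ (λ t → *-distribʳ-sum (y t) (λ i → c i * X i t)) ⟨
    ∑[ t < n ] (∑[ i < m ] (c i * X i t) * y t) ∎

  ∑-split : ∀ m {n} (f : Fin (m ℕ.+ n) → Carrier) →
            sum f ≡ ∑[ i < m ] f (i ↑ˡ n) + ∑[ j < n ] f (m ↑ʳ j)
  ∑-split zero    f = sym (+-identityˡ _)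
  ∑-split (suc m) f = trans (cong (f zero +_) (∑-split m (f ∘ suc))) (sym (+-assoc _ _ _))

  -- The Kronecker delta: `δ i` serves as the coefficient vector that picks out the i-th member of a
  -- family.
  δ : ∀ {n} → Fin n → Fin n → Carrier
  δ zero    zero    = 1#
  δ zero    (suc j) = 0#
  δ (suc i) zero    = 0#
  δ (suc i) (suc j) = δ i j

  δ-diag : ∀ {n} (i : Fin n) → δ i i ≡ 1#
  δ-diag zero    = refl
  δ-diag (suc i) = δ-diag i

  δ≡1⇒≡ : ∀ {n} (i j : Fin n) → δ i j ≡ 1# → i ≡ j
  δ≡1⇒≡ zero    zero    _   = refl
  δ≡1⇒≡ zero    (suc j) 0≡1 = contradiction 0≡1 0≢1
  δ≡1⇒≡ (suc i) zero    0≡1 = contradiction 0≡1 0≢1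
  δ≡1⇒≡ (suc i) (suc j) eq  = cong suc (δ≡1⇒≡ i j eq)

  ∑-δ : ∀ {n} (i : Fin n) (x : Fin n → Carrier) → ∑[ j < n ] (δ i j * x j) ≡ x i
  ∑-δ zero    x = trans (cong₂ _+_ (*-identityˡ _) (∑-zero (λ j → zeroˡ (x (suc j))))) (+-identityʳ _)
  ∑-δ (suc i) x = trans (cong₂ _+_ (zeroˡ _) (∑-δ i (x ∘ suc))) (+-identityˡ _)

-- Linear independence and rank

module LinAlgProperties (K : Field) where
  open Field K using (Carrier; _+_; _*_; -_; 0#; 1#; 0≢1; inverse)
  open FieldProperties K
  open LinAlg K

  lincomb≡∑ : ∀ {m n} (c : Fin m → Carrier) (v : Fin m → Vector n) k →
              lincomb c v k ≡ ∑[ i < m ] (c i * v i k)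
  lincomb≡∑ {zero}  c v k = refl
  lincomb≡∑ {suc m} c v k = cong (c zero * v zero k +_) (lincomb≡∑ (c ∘ suc) (v ∘ suc) k)

  module _ {m n : ℕ} {v : Fin m → Vector n} where
    mkLinIndep : (∀ c → (∀ k → ∑[ i < m ] (c i * v i k) ≡ 0#) → ∀ i → c i ≡ 0#) → LinIndep v
    mkLinIndep h c cv≈0 = h c (λ k → trans (sym (lincomb≡∑ c v k)) (cv≈0 k))

    ∑≡0⇒≡0 : LinIndep v → ∀ c → (∀ k → ∑[ i < m ] (c i * v i k) ≡ 0#) → ∀ i → c i ≡ 0#
    ∑≡0⇒≡0 v-ind c h = v-ind c (λ k → trans (lincomb≡∑ c v k) (h k))

  module _ {m n : ℕ} {v : Fin m → Vector n} where
    LinIndep-resp : {w : Fin m → Vector n} → (∀ i → v i ≈V w i) → LinIndep v → LinIndep w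
    LinIndep-resp v≈w v-ind = mkLinIndep λ c h →
      ∑≡0⇒≡0 v-ind c λ k → trans (sum-cong-≗ (λ i → cong (c i *_) (v≈w i k))) (h k)

    LinIndep⇒≉0 : LinIndep v → ∀ i → ¬ (v i ≈V zeroV)
    LinIndep⇒≉0 v-ind i vi≈0 = 0≢1 (trans
      (sym (∑≡0⇒≡0 v-ind (δ i) (λ k → trans (∑-δ i (λ j → v j k)) (vi≈0 k)) i))
      (δ-diag i))

    -- If `v i` and `v j` agree, then `δ i` minus `δ j` is a relation, so it vanishes. Its entry at
    -- i gives `δ j i` = 1.
    LinIndep⇒injective : LinIndep v → ∀ i j → v i ≈V v j → i ≡ j
    LinIndep⇒injective v-ind i j vi≈vj = sym (δ≡1⇒≡ j i (sym (x-y≡0⇒x≡y _ _ (trans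
      (cong₂ _+_ (sym (δ-diag i)) (sym (-1*x≈-x _)))
      (∑≡0⇒≡0 v-ind (λ l → δ i l + - 1# * δ j l) (λ k → begin
        ∑[ l < m ] ((δ i l + - 1# * δ j l) * v l k)
          ≡⟨ ∑-distribʳ (δ i) _ (λ l → v l k) ⟩
        ∑[ l < m ] (δ i l * v l k) + ∑[ l < m ] (- 1# * δ j l * v l k)
          ≡⟨ cong₂ _+_ (∑-δ i (λ l → v l k)) (∑-factorˡ (- 1#) (δ j) (λ l → v l k)) ⟩
        v i k + - 1# * ∑[ l < m ] (δ j l * v l k)
          ≡⟨ cong (v i k +_) (trans (-1*x≈-x _) (cong -_ (∑-δ j (λ l → v l k)))) ⟩
        v i k + - v j k
          ≡⟨ cong (λ x → x + - v j k) (vi≈vj k) ⟩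
        v j k + - v j k
          ≡⟨ -‿inverseʳ (v j k) ⟩
        0# ∎) i)))))

    LinIndep-scale : ∀ {a} → a ≢ 0# → LinIndep v → LinIndep (λ i → a ·V v i)
    LinIndep-scale {a} a≢0 v-ind = mkLinIndep λ c h i →
      x*y≡0⇒y≡0 a≢0 (trans (*-comm a (c i)) (∑≡0⇒≡0 v-ind (λ j → c j * a)
        (λ k → trans (sum-cong-≗ (λ j → *-assoc (c j) a (v j k))) (h k)) i))

    InSpan-scale⁻ : ∀ {a x} → InSpan (λ i → a ·V v i) x → InSpan v x
    InSpan-scale⁻ {a} {x} (c , h) = (λ j → c j * a) , λ k → begin
      lincomb (λ j → c j * a) v k         ≡⟨ lincomb≡∑ _ v k ⟩
      ∑[ j < m ] (c j * a * v j k)        ≡⟨ sum-cong-≗ (λ j → *-assoc (c j) a (v j k)) ⟩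
      ∑[ j < m ] (c j * (a * v j k))      ≡⟨ lincomb≡∑ c (λ i → a ·V v i) k ⟨
      lincomb c (λ i → a ·V v i) k        ≡⟨ h k ⟩
      x k                                 ∎

  module _ {l m n : ℕ} (X : Fin l → Vector m) {w : Fin m → Vector n} where
    -- The `X i` are coordinate vectors with respect to `w`. A relation c among the combinations is
    -- the relation cX among the `w t`, so cX = 0 and then c = 0.
    LinIndep-combine : LinIndep X → LinIndep w →
                       LinIndep (λ i k → ∑[ t < m ] (X i t * w t k))
    LinIndep-combine X-ind w-ind = mkLinIndep λ c h →
      ∑≡0⇒≡0 X-ind c (∑≡0⇒≡0 w-ind _ λ k → trans (sym (∑-assoc c X (λ t → w t k))) (h k))

    -- A relation among coordinate vectors carries over to the combinations, whether or not `w` is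
    -- independent.
    LinIndep-combine⁻ : LinIndep (λ i k → ∑[ t < m ] (X i t * w t k)) → LinIndep X
    LinIndep-combine⁻ Xw-ind = mkLinIndep λ c h →
      ∑≡0⇒≡0 Xw-ind c λ k → trans (∑-assoc c X (λ t → w t k))
        (∑-zero (λ t → trans (cong (_* w t k) (h t)) (zeroˡ _)))

  -- In a relation on `u ++ v` the part from `u` is the negative of the part from `v`. It lies in
  -- both spans, so both parts are zero and each family can be treated alone.
  LinIndep-++ : ∀ {l m n} {u : Fin l → Vector n} {v : Fin m → Vector n} →
                LinIndep u → LinIndep v →
                (∀ x → InSpan u x → InSpan v x → x ≈V zeroV) → LinIndep (u ++ v)
  LinIndep-++ {l} {m} {n} {u} {v} u-ind v-ind disjoint = mkLinIndep λ c h i →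
    subst (λ j → c j ≡ 0#) (join-splitAt l m i) (coeff≡0 c h (splitAt l i))
    where
    module _ (c : Fin (l ℕ.+ m) → Carrier)
             (h : ∀ k → ∑[ i < l ℕ.+ m ] (c i * (u ++ v) i k) ≡ 0#) where
      cu = c ∘ (_↑ˡ m)
      cv = c ∘ (l ↑ʳ_)

      split≡0 : ∀ k → ∑[ i < l ] (cu i * u i k) + ∑[ j < m ] (cv j * v j k) ≡ 0#
      split≡0 k = begin
        ∑[ i < l ] (cu i * u i k) + ∑[ j < m ] (cv j * v j k)
          ≡⟨ cong₂ _+_ (sum-cong-≗ (λ i → cong (λ x → cu i * x k) (lookup-++ˡ u v i)))
                       (sum-cong-≗ (λ j → cong (λ x → cv j * x k) (lookup-++ʳ u v j))) ⟨
        _ ≡⟨ ∑-split l (λ i → c i * (u ++ v) i k) ⟨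
        _ ≡⟨ h k ⟩
        0# ∎

      u-part : ∀ k → ∑[ i < l ] (cu i * u i k) ≡ 0#
      u-part k = trans (sym (lincomb≡∑ cu u k))
        (disjoint (lincomb cu u) (cu , λ _ → refl)
          ((λ j → - 1# * cv j) , λ k → begin
            lincomb (λ j → - 1# * cv j) v k     ≡⟨ lincomb≡∑ _ v k ⟩
            ∑[ j < m ] (- 1# * cv j * v j k)    ≡⟨ ∑-factorˡ (- 1#) cv (λ j → v j k) ⟩
            - 1# * ∑[ j < m ] (cv j * v j k)    ≡⟨ -1*x≈-x _ ⟩
            - (∑[ j < m ] (cv j * v j k))       ≡⟨ inverseʳ-unique _ _ (trans (+-comm _ _) (split≡0 k)) ⟨
            ∑[ i < l ] (cu i * u i k)           ≡⟨ lincomb≡∑ cu u k ⟨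
            lincomb cu u k                      ∎) k)

      v-part : ∀ k → ∑[ j < m ] (cv j * v j k) ≡ 0#
      v-part k = trans (sym (+-identityˡ _))
        (trans (cong (_+ ∑[ j < m ] (cv j * v j k)) (sym (u-part k))) (split≡0 k))

      coeff≡0 : ∀ s → c (join l m s) ≡ 0#
      coeff≡0 (inj₁ i) = ∑≡0⇒≡0 u-ind cu u-part i
      coeff≡0 (inj₂ j) = ∑≡0⇒≡0 v-ind cv v-part j

  -- A relation c among the modified vectors is a relation on `w` in which `w zero` receives the
  -- coefficient ∑ c t * f t and the others keep theirs.
  LinIndep-eliminate : ∀ {m n} {w : Fin (suc m) → Vector n} (f : Fin m → Carrier) → LinIndep w →
                       LinIndep (λ t → w (suc t) +V (f t ·V w zero))
  LinIndep-eliminate {m} {w = w} f w-ind = mkLinIndep λ c h t →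
    ∑≡0⇒≡0 {v = w} w-ind (λ { zero → ∑[ t < m ] (c t * f t) ; (suc t) → c t }) (λ k → begin
      ∑[ t < m ] (c t * f t) * w zero k + ∑[ t < m ] (c t * w (suc t) k)
        ≡⟨ +-comm _ _ ⟩
      ∑[ t < m ] (c t * w (suc t) k) + ∑[ t < m ] (c t * f t) * w zero k
        ≡⟨ cong (_ +_) (trans (*-distribʳ-sum (w zero k) (λ t → c t * f t))
                              (sum-cong-≗ (λ t → *-assoc (c t) (f t) (w zero k)))) ⟩
      ∑[ t < m ] (c t * w (suc t) k) + ∑[ t < m ] (c t * (f t * w zero k))
        ≡⟨ ∑-distribˡ c _ _ ⟨
      ∑[ t < m ] (c t * (w (suc t) k + f t * w zero k))
        ≡⟨ h k ⟩
      0# ∎) (suc t)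

  RankIs-resp : ∀ {m n k} {A B : Matrix m n} → A ≈M B → RankIs A k → RankIs B k
  RankIs-resp A≈B ((s , s-ind) , maximal) =
    (s , LinIndep-resp (λ t i → A≈B i (s t)) s-ind) ,
    λ s′ s′-ind → maximal s′ (LinIndep-resp (λ t i → sym (A≈B i (s′ t))) s′-ind)

  RankIs⇒≉zeroM : ∀ {m n k} {A : Matrix m n} → RankIs A (suc k) → ¬ (A ≈M zeroM)
  RankIs⇒≉zeroM {A = A} ((s , s-ind) , _) A≈0 =
    LinIndep⇒≉0 {v = λ t → col A (s t)} s-ind zero (λ a → A≈0 a (s zero))

  module _ (_≟_ : DecidableEquality Carrier) where

    -- Row rank equals column rank, in the form: m independent columns have m independent rows.
    -- Gaussian elimination: pivot on a nonzero entry of w zero and clear its row.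
    independent-rows : ∀ {m n} (w : Fin m → Vector n) → LinIndep w →
                       Σ (Fin m → Fin n) λ s → LinIndep (λ u t → w t (s u))
    independent-rows {zero}      w w-ind = (λ ()) , λ _ _ ()
    independent-rows {suc m} {n} w w-ind
      -- Decidable equality is what turns "not all entries are zero" into an actual pivot position
      -- `a`.
      with a , w₀a≢0 ← ¬∀⟶∃¬ n (λ k → w zero k ≡ 0#) (λ k → w zero k ≟ 0#) (LinIndep⇒≉0 {v = w} w-ind zero)
      with b , w₀a*b≡1 ← inverse (w zero a) w₀a≢0
      = s , mkLinIndep {v = λ u t → w t (s u)} s-ind
      where
      f : Fin m → Carrier
      f t = - w (suc t) a * b

      w′ : Fin m → Vector n
      w′ t = w (suc t) +V (f t ·V w zero)

      rec : Σ (Fin m → Fin n) λ s → LinIndep (λ u t → w′ t (s u))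
      rec = independent-rows w′ (LinIndep-eliminate {w = w} f w-ind)

      s′ = proj₁ rec

      s : Fin (suc m) → Fin n
      s zero    = a
      s (suc u) = s′ u

      pivot-cleared : ∀ t → w′ t a ≡ 0#
      pivot-cleared t = begin
        w (suc t) a + - w (suc t) a * b * w zero a    ≡⟨ cong (_ +_) (*-assoc _ _ _) ⟩
        w (suc t) a + - w (suc t) a * (b * w zero a)  ≡⟨ cong (λ x → _ + - w (suc t) a * x) (trans (*-comm _ _) w₀a*b≡1) ⟩
        w (suc t) a + - w (suc t) a * 1#              ≡⟨ cong (_ +_) (*-identityʳ _) ⟩
        w (suc t) a + - w (suc t) a                   ≡⟨ -‿inverseʳ _ ⟩
        0#                                            ∎

      module _ (c : Fin (suc m) → Carrier)
               (h : ∀ t → ∑[ u < suc m ] (c u * w t (s u)) ≡ 0#) where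
        -- Adding `f t` times relation `zero` to relation `suc t` gives a relation on `w′ t`, from
        -- which the pivot row drops out because its entry was cleared.
        rows′≡0 : ∀ t → ∑[ u < m ] (c (suc u) * w′ t (s′ u)) ≡ 0#
        rows′≡0 t = begin
          ∑[ u < m ] (c (suc u) * w′ t (s′ u))
            ≡⟨ +-identityˡ _ ⟨
          0# + ∑[ u < m ] (c (suc u) * w′ t (s′ u))
            ≡⟨ cong (_+ ∑[ u < m ] (c (suc u) * w′ t (s′ u)))
                    (trans (cong (c zero *_) (pivot-cleared t)) (zeroʳ _)) ⟨
          ∑[ u < suc m ] (c u * w′ t (s u))
            ≡⟨ ∑-distribˡ c (λ u → w (suc t) (s u)) (λ u → f t * w zero (s u)) ⟩
          ∑[ u < suc m ] (c u * w (suc t) (s u)) + ∑[ u < suc m ] (c u * (f t * w zero (s u)))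
            ≡⟨ cong₂ _+_ (h (suc t)) (sum-cong-≗ (λ u → x∙yz≈y∙xz (c u) (f t) (w zero (s u)))) ⟩
          0# + ∑[ u < suc m ] (f t * (c u * w zero (s u)))
            ≡⟨ +-identityˡ _ ⟩
          ∑[ u < suc m ] (f t * (c u * w zero (s u)))
            ≡⟨ *-distribˡ-sum (f t) (λ u → c u * w zero (s u)) ⟨
          f t * ∑[ u < suc m ] (c u * w zero (s u))
            ≡⟨ cong (f t *_) (h zero) ⟩
          f t * 0#
            ≡⟨ zeroʳ (f t) ⟩
          0# ∎
          where open import Algebra.Properties.CommutativeSemigroup
                  (CommutativeMonoid.commutativeSemigroup *-commutativeMonoid) using (x∙yz≈y∙xz)

        tail≡0 : ∀ u → c (suc u) ≡ 0#
        tail≡0 = ∑≡0⇒≡0 (proj₂ rec) (c ∘ suc) rows′≡0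

        s-ind : ∀ u → c u ≡ 0#
        s-ind (suc u) = tail≡0 u
        -- With the other coefficients zero, relation `zero` reduces to `c zero` times the nonzero
        -- pivot.
        s-ind zero    = x*y≡0⇒y≡0 w₀a≢0 (begin
          w zero a * c zero
            ≡⟨ *-comm _ _ ⟩
          c zero * w zero a
            ≡⟨ +-identityʳ _ ⟨
          c zero * w zero a + 0#
            ≡⟨ cong (_ +_) (∑-zero (λ u → trans (cong (_* w zero (s′ u)) (tail≡0 u)) (zeroˡ _))) ⟨
          ∑[ u < suc m ] (c u * w zero (s u))
            ≡⟨ h zero ⟩
          0# ∎)

    -- Independence would yield m+1 independent rows chosen among m. By the pigeonhole principle one
    -- row is chosen twice, but independent vectors are distinct.
    m+1-dependent : ∀ {m} (X : Fin (suc m) → Vector m) → ¬ LinIndep X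
    m+1-dependent X X-ind with s , s-ind ← independent-rows X X-ind
      with i , j , i<j , si≡sj ← pigeonhole (ℕ.n<1+n _) s
      = Fin.<⇒≢ i<j (LinIndep⇒injective {v = λ u t → X t (s u)} s-ind i j (λ t → cong (X t) si≡sj))

    -- Column b is the combination of the `x t` with coefficient vector `λ t → z t b`. Independent
    -- rows taken from `z` give k independent columns; k+1 independent columns would give k+1
    -- independent coefficient vectors of length k.
    rank-product : ∀ {m n k} {x : Fin k → Vector m} {z : Fin k → Vector n} →
                   LinIndep x → LinIndep z → RankIs (λ a b → ∑[ t < k ] (z t b * x t a)) k
    rank-product {x = x} {z} x-ind z-ind =
      (let s , s-ind = independent-rows z z-ind in
       s , LinIndep-combine (λ u t → z t (s u)) {x} s-ind x-ind) ,
      λ s Ax-ind → m+1-dependent (λ u t → z t (s u)) (LinIndep-combine⁻ (λ u t → z t (s u)) {x} Ax-ind)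

-- Hermitian matrices from subspaces, for an abstract conjugation

record IsInvolutiveEndomorphism (K : Field) (σ : Field.Carrier K → Field.Carrier K) : Set where
  open Field K using (_+_; _*_)
  field
    σ-+          : ∀ x y → σ (x + y) ≡ σ x + σ y
    σ-*          : ∀ x y → σ (x * y) ≡ σ x * σ y
    σ-involutive : ∀ x → σ (σ x) ≡ x

module HermitianDifferences (K : Field) (_≟_ : DecidableEquality (Field.Carrier K))
  (σ : Field.Carrier K → Field.Carrier K) (σ-isInvolutive : IsInvolutiveEndomorphism K σ) where

  open Field K using (Carrier; _+_; _*_; -_; 0#; 1#)
  open IsInvolutiveEndomorphism σ-isInvolutive
  open FieldProperties K
  open LinAlg K
  open LinAlgProperties K

  σ-0 : σ 0# ≡ 0#
  σ-0 = x+x≈x⇒x≈0 (σ 0#) (trans (sym (σ-+ 0# 0#)) (cong σ (+-identityˡ 0#)))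

  σ-neg : ∀ x → σ (- x) ≡ - σ x
  σ-neg x = inverseʳ-unique (σ x) (σ (- x))
    (trans (sym (σ-+ x (- x))) (trans (cong σ (-‿inverseʳ x)) σ-0))

  σ-∑ : ∀ {n} (f : Fin n → Carrier) → σ (sum f) ≡ ∑[ i < n ] σ (f i)
  σ-∑ {zero}  f = σ-0
  σ-∑ {suc n} f = trans (σ-+ _ _) (cong (σ (f zero) +_) (σ-∑ (f ∘ suc)))

  -- Applying `σ` to a relation c among the conjugates gives the relation `σ ∘ c` among the original
  -- vectors. Hence `σ ∘ c` vanishes, and so does c by involutivity.
  LinIndep-σ : ∀ {m n} {v : Fin m → Vector n} → LinIndep v → LinIndep (λ i k → σ (v i k))
  LinIndep-σ {m} {v = v} v-ind = mkLinIndep λ c h i → begin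
    c i          ≡⟨ σ-involutive (c i) ⟨
    σ (σ (c i))  ≡⟨ cong σ (∑≡0⇒≡0 {v = v} v-ind (σ ∘ c) (λ k → begin
      ∑[ j < m ] (σ (c j) * v j k)
        ≡⟨ sum-cong-≗ (λ j → trans (σ-* (c j) (σ (v j k))) (cong (σ (c j) *_) (σ-involutive (v j k)))) ⟨
      ∑[ j < m ] σ (c j * σ (v j k))
        ≡⟨ σ-∑ (λ j → c j * σ (v j k)) ⟨
      σ (∑[ j < m ] (c j * σ (v j k)))
        ≡⟨ cong σ (h k) ⟩
      σ 0#
        ≡⟨ σ-0 ⟩
      0# ∎) i) ⟩
    σ 0#         ≡⟨ σ-0 ⟩
    0#           ∎

  -- This is V V* for the matrix V with columns `v t`. The conjugated factor comes first to match
  -- the shape in `rank-product`.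
  gram : ∀ {r n} → (Fin r → Vector n) → Matrix n n
  gram {r} v a b = ∑[ t < r ] (σ (v t b) * v t a)

  gram-hermitian : ∀ {r n} (v : Fin r → Vector n) a b → σ (gram v b a) ≡ gram v a b
  gram-hermitian {r} v a b = trans (σ-∑ (λ t → σ (v t a) * v t b)) (sum-cong-≗ (λ t → begin
    σ (σ (v t a) * v t b)      ≡⟨ σ-* _ _ ⟩
    σ (σ (v t a)) * σ (v t b)  ≡⟨ cong (_* σ (v t b)) (σ-involutive (v t a)) ⟩
    v t a * σ (v t b)          ≡⟨ *-comm _ _ ⟩
    σ (v t b) * v t a          ∎))

  -- If X has columns u ++ -v and Z has columns u ++ v, then gram u - gram v = X Z*.
  rank-gram-difference : ∀ {r n} {u v : Fin r → Vector n} → LinIndep u → LinIndep v →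
    (∀ x → InSpan u x → InSpan v x → x ≈V zeroV) → RankIs (gram u -M gram v) (2 ℕ.* r)
  rank-gram-difference {r} {n} {u} {v} u-ind v-ind disjoint =
    -- `2 * r` unfolds to `r + (r + 0)`, whereas the concatenated family has `r + r` members.
    subst (RankIs (gram u -M gram v)) (cong (r ℕ.+_) (sym (ℕ.+-identityʳ r)))
      (RankIs-resp product≈difference (rank-product _≟_ {x = u ++ -v} {z = λ t k → σ ((u ++ v) t k)}
        -- Negating `v` keeps it independent, and a vector in the span of `-v` is in that of `v`, so
        -- `disjoint` serves both factors.
        (LinIndep-++ u-ind (LinIndep-scale -1≢0 v-ind)
          (λ x x∈u x∈-v → disjoint x x∈u (InSpan-scale⁻ x∈-v)))
        (LinIndep-σ (LinIndep-++ u-ind v-ind disjoint))))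
    where
    -v : Fin r → Vector n
    -v t = (- 1#) ·V v t

    product≈difference : (λ a b → ∑[ t < r ℕ.+ r ] (σ ((u ++ v) t b) * (u ++ -v) t a))
                         ≈M (gram u -M gram v)
    product≈difference a b = begin
      ∑[ t < r ℕ.+ r ] (σ ((u ++ v) t b) * (u ++ -v) t a)
        ≡⟨ ∑-split r _ ⟩
      _
        ≡⟨ cong₂ _+_
             (sum-cong-≗ (λ t → cong₂ (λ x y → σ (x b) * y a) (lookup-++ˡ u v t) (lookup-++ˡ u -v t)))
             (sum-cong-≗ (λ t → cong₂ (λ x y → σ (x b) * y a) (lookup-++ʳ u v t) (lookup-++ʳ u -v t))) ⟩
      gram u a b + ∑[ t < r ] (σ (v t b) * (- 1# * v t a))
        ≡⟨ cong (gram u a b +_) (sum-cong-≗ (λ t → x∙yz≈y∙xz (σ (v t b)) (- 1#) (v t a))) ⟩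
      gram u a b + ∑[ t < r ] (- 1# * (σ (v t b) * v t a))
        ≡⟨ cong (gram u a b +_) (*-distribˡ-sum (- 1#) (λ t → σ (v t b) * v t a)) ⟨
      gram u a b + - 1# * gram v a b
        ≡⟨ cong (gram u a b +_) (-1*x≈-x (gram v a b)) ⟩
      gram u a b + - gram v a b ∎
      where open import Algebra.Properties.CommutativeSemigroup
              (CommutativeMonoid.commutativeSemigroup *-commutativeMonoid) using (x∙yz≈y∙xz)

  -- The family is nonempty so that `H zero` exists, and the dimension `suc r` is positive so that
  -- matrices of rank `2 * suc r` are nonzero.
  module DifferenceSet {n r N : ℕ} (S : Fin (suc N) → Fin (suc r) → Vector n)
    (S-ind : ∀ i → LinIndep (S i))
    (S-disjoint : ∀ i j → i ≢ j → ∀ x → InSpan (S i) x → InSpan (S j) x → x ≈V zeroV) where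

    H : Fin (suc N) → Matrix n n
    H i = gram (S i)

    -- H i itself has rank only r; subtracting H zero leaves the distances unchanged and makes
    -- the nonzero elements distances to the zero matrix U zero.
    U : Fin (suc N) → Matrix n n
    U i = H i -M H zero

    H-distance : ∀ i j → i ≢ j → RankIs (H i -M H j) (2 ℕ.* suc r)
    H-distance i j i≢j = rank-gram-difference {u = S i} {S j} (S-ind i) (S-ind j) (S-disjoint i j i≢j)

    U-hermitian : ∀ i a b → σ (U i b a) ≡ U i a b
    U-hermitian i a b = begin
      σ (H i b a + - H zero b a)      ≡⟨ σ-+ _ _ ⟩
      σ (H i b a) + σ (- H zero b a)  ≡⟨ cong (σ (H i b a) +_) (σ-neg _) ⟩
      σ (H i b a) + - σ (H zero b a)  ≡⟨ cong₂ (λ x y → x + - y) (gram-hermitian (S i) a b)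
                                               (gram-hermitian (S zero) a b) ⟩
      H i a b + - H zero a b          ∎

    U-difference : ∀ i j → (H i -M H j) ≈M (U i -M U j)
    U-difference i j a b = sym (begin
      (x + - z) + - (y + - z)      ≡⟨ cong ((x + - z) +_) (⁻¹-anti-homo‿- y z) ⟩
      (x + - z) + (z + - y)        ≡⟨ +-assoc x (- z) (z + - y) ⟩
      x + (- z + (z + - y))        ≡⟨ cong (x +_) (+-assoc (- z) z (- y)) ⟨
      x + ((- z + z) + - y)        ≡⟨ cong (λ w → x + (w + - y)) (-‿inverseˡ z) ⟩
      x + (0# + - y)               ≡⟨ cong (x +_) (+-identityˡ (- y)) ⟩
      x + - y                      ∎)
      where
      open import Algebra.Properties.AbelianGroup +-abelianGroup using (⁻¹-anti-homo‿-)
      x = H i a b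
      y = H j a b
      z = H zero a b

    U-distance : ∀ i j → i ≢ j → RankIs (U i -M U j) (2 ℕ.* suc r)
    U-distance i j i≢j = RankIs-resp (U-difference i j) (H-distance i j i≢j)

    -- Distinct indices give a difference of positive rank, which cannot be zero. Decidability of
    -- equality on `Fin` removes the double negation.
    U-injective : ∀ i j → U i ≈M U j → i ≡ j
    U-injective i j Ui≈Uj = decidable-stable (i Fin.≟ j) λ i≢j →
      RankIs⇒≉zeroM (U-distance i j i≢j)
        (λ a b → trans (cong (_+ - U j a b) (Ui≈Uj a b)) (-‿inverseʳ (U j a b)))

    U-rank : ∀ i → ¬ (U i ≈M zeroM) → RankIs (U i) (2 ℕ.* suc r)
    U-rank zero    U₀≉0 = ⊥-elim (U₀≉0 λ a b → -‿inverseʳ (H zero a b))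
    U-rank (suc i) _    = H-distance (suc i) zero λ ()

  partialSpread⇒constRankDist : ∀ {n r N} → 1 ≤ r → PartialSpread n r N →
    Σ (Fin N → Matrix n n) λ U →
      (∀ i j → U i ≈M U j → i ≡ j)
      × (∀ i a b → σ (U i b a) ≡ U i a b)
      × (∀ i j → i ≢ j → RankIs (U i -M U j) (2 ℕ.* r))
      × (∀ i → ¬ (U i ≈M zeroM) → RankIs (U i) (2 ℕ.* r))
  -- Without members there is no `H zero` to subtract, and the empty family satisfies everything.
  partialSpread⇒constRankDist {r = suc r} {zero}  _ _ = (λ ()) , (λ ()) , (λ ()) , (λ ()) , λ ()
  partialSpread⇒constRankDist {r = suc r} {suc N} _ (S , S-ind , S-disjoint) =
    U , U-injective , U-hermitian , U-distance , U-rank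
    where open DifferenceSet S S-ind S-disjoint

-- Reindexing sums over a finite type

module FiniteSums (M : CommutativeMonoid 0ℓ 0ℓ) where
  open CommutativeMonoid M renaming (trans to ≈-trans)
  open import Algebra.Properties.CommutativeMonoid.Sum M using (sum; sum-permute; sum-cong-≗)

  -- Conjugating `π` by the enumeration gives a permutation of `Fin n`. The monoid is arbitrary
  -- because the result is used for sums under translation and for products under scaling.
  sum-reindex : ∀ {A : Set} {n} (enum : A ↔ Fin n) (π : A ↔ A) (g : A → Carrier) →
                sum (g ∘ Inverse.from enum) ≈ sum (g ∘ Inverse.to π ∘ Inverse.from enum)
  sum-reindex enum π g = ≈-trans
    (sum-permute (g ∘ Inverse.from enum) (enum ↔-∘ (π ↔-∘ ↔-sym enum)))
    (reflexive (sum-cong-≗ {x = g ∘ Inverse.from enum ∘ Inverse.to enum ∘ Inverse.to π ∘ Inverse.from enum}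
      λ i → cong g (Inverse.strictlyInverseʳ enum (Inverse.to π (Inverse.from enum i)))))

-- Divisibility of binomial coefficients by a prime

prime∣n!⇒≤ : ∀ {p} n → Prime p → p ∣ n ! → p ≤ n
prime∣n!⇒≤ zero    p-prime p∣1 =
  contradiction (∣⇒≤ p∣1) (ℕ.<⇒≱ (ℕ.nonTrivial⇒n>1 _ {{prime⇒nonTrivial p-prime}}))
prime∣n!⇒≤ (suc n) p-prime p∣[1+n]! with euclidsLemma (suc n) (n !) p-prime p∣[1+n]!
... | inj₁ p∣1+n = ∣⇒≤ p∣1+n
... | inj₂ p∣n!  = ℕ.m≤n⇒m≤1+n (prime∣n!⇒≤ n p-prime p∣n!)

-- The prime divides p! = C(p,k) · k! · (p-k)!, but it divides neither k! nor (p-k)!, since k and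
-- p-k are smaller than p.
prime∣pCk : ∀ {p k} → Prime p → 1 ≤ k → k ℕ.< p → p ∣ p C k
prime∣pCk {suc p} {k} p-prime 1≤k k<p with euclidsLemma (suc p C k) _ p-prime
    (subst (suc p ∣_) p!≡pCk*k![p-k]! (m∣m*n (p !)))
  where
  instance _ = k ℕ.!* (suc p ℕ.∸ k) !≢0
  p!≡pCk*k![p-k]! : suc p ! ≡ (suc p C k) ℕ.* (k ! ℕ.* (suc p ℕ.∸ k) !)
  p!≡pCk*k![p-k]! = sym (trans (cong (ℕ._* (k ! ℕ.* (suc p ℕ.∸ k) !)) (nCk≡n!/k![n-k]! (ℕ.<⇒≤ k<p)))
                               (m/n*n≡m (k![n∸k]!∣n! (ℕ.<⇒≤ k<p))))
... | inj₁ p∣pCk = p∣pCk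
... | inj₂ p∣k![p-k]! with euclidsLemma (k !) _ p-prime p∣k![p-k]!
...   | inj₁ p∣k!     = contradiction (prime∣n!⇒≤ k p-prime p∣k!) (ℕ.<⇒≱ k<p)
...   | inj₂ p∣[p-k]! = contradiction (prime∣n!⇒≤ (suc p ℕ.∸ k) p-prime p∣[p-k]!)
                                      (ℕ.<⇒≱ (ℕ.∸-monoʳ-< 1≤k (ℕ.<⇒≤ k<p)))

-- The Frobenius map in characteristic p

module Frobenius (K : Field) where
  open Field K using (Carrier; _+_; _*_; 0#; 1#)
  open FieldProperties K
  open import Algebra.Properties.Semiring.Mult semiring
    using (×-congʳ; ×-comm-*; ×-assocˡ; ×-homo-1) renaming (_×_ to _·_)
  open import Algebra.Properties.CommutativeSemiring.Exp commutativeSemiring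
    using (_^_; ^-distrib-*; ^-assocʳ)
  open import Algebra.Properties.CommutativeSemiring.Binomial commutativeSemiring
    using (binomialTerm) renaming (theorem to binomial-theorem)
  open import Algebra.Properties.CommutativeMonoid.Sum +-commutativeMonoid using (sum-init-last)

  -- Makes the library's exponent laws available for the power function of `Field`, in which
  -- hermitian matrices are defined.
  field-^≡^ : ∀ x n → Field._^_ K x n ≡ x ^ n
  field-^≡^ x zero    = refl
  field-^≡^ x (suc n) = cong (x *_) (field-^≡^ x n)

  module _ {p : ℕ} (p×1≡0 : p · 1# ≡ 0#) where
    p×≡0 : ∀ x → p · x ≡ 0#
    p×≡0 x = begin
      p · x         ≡⟨ ×-congʳ p (*-identityʳ x) ⟨
      p · (x * 1#)  ≡⟨ ×-comm-* p x 1# ⟨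
      x * (p · 1#)  ≡⟨ cong (x *_) p×1≡0 ⟩
      x * 0#        ≡⟨ zeroʳ x ⟩
      0#            ∎

    p∣n⇒n×≡0 : ∀ {n} → p ∣ n → ∀ x → n · x ≡ 0#
    p∣n⇒n×≡0 (divides k refl) x = trans (cong (_· x) (ℕ.*-comm k p))
      (trans (sym (×-assocˡ x p k)) (p×≡0 (k · x)))

  -- In the binomial expansion every term except the two outer ones has a coefficient divisible by
  -- p, hence vanishes.
  ^p-+ : ∀ {p} → Prime p → p · 1# ≡ 0# → ∀ x y → (x + y) ^ p ≡ x ^ p + y ^ p
  ^p-+ {suc p} p-prime p×1≡0 x y = begin
    (x + y) ^ suc p
      ≡⟨ binomial-theorem (suc p) x y ⟩
    term zero + sum (term ∘ suc)
      ≡⟨ cong (term zero +_) (sum-init-last (term ∘ suc)) ⟩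
    term zero + (sum (term ∘ suc ∘ inject₁) + term (suc (fromℕ p)))
      ≡⟨ cong₂ (λ a b → a + (sum (term ∘ suc ∘ inject₁) + b)) first last ⟩
    y ^ suc p + (sum (term ∘ suc ∘ inject₁) + x ^ suc p)
      ≡⟨ cong (λ a → y ^ suc p + (a + x ^ suc p)) (∑-zero middle) ⟩
    y ^ suc p + (0# + x ^ suc p)
      ≡⟨ cong (y ^ suc p +_) (+-identityˡ _) ⟩
    y ^ suc p + x ^ suc p
      ≡⟨ +-comm _ _ ⟩
    x ^ suc p + y ^ suc p ∎
    where
    term : Fin (suc (suc p)) → Carrier
    term = binomialTerm x y (suc p)

    first : term zero ≡ y ^ suc p
    first = trans (×-homo-1 _) (*-identityˡ _)

    last : term (suc (fromℕ p)) ≡ x ^ suc p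
    last rewrite Fin.toℕ-fromℕ p | nCn≡1 (suc p) | ℕ.n∸n≡0 p = trans (×-homo-1 _) (*-identityʳ _)

    middle : ∀ i → term (suc (inject₁ i)) ≡ 0#
    -- The prime is `suc p` here, and the index stands for k = i + 1 with i < p, hence strictly
    -- between 0 and the prime.
    middle i = p∣n⇒n×≡0 p×1≡0 (prime∣pCk p-prime (s≤s z≤n)
      (s≤s (subst (ℕ._< p) (sym (Fin.toℕ-inject₁ i)) (Fin.toℕ<n i)))) _

  -- Iterates `^p-+` m times, since raising to the power p^(m+1) is raising to p and then to p^m.
  ^p^m-+ : ∀ {p} → Prime p → p · 1# ≡ 0# →
           ∀ m x y → (x + y) ^ (p ℕ.^ m) ≡ x ^ (p ℕ.^ m) + y ^ (p ℕ.^ m)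
  ^p^m-+ {p} p-prime p×1≡0 zero    x y =
    trans (*-identityʳ _) (sym (cong₂ _+_ (*-identityʳ x) (*-identityʳ y)))
  ^p^m-+ {p} p-prime p×1≡0 (suc m) x y = begin
    (x + y) ^ (p ℕ.* p ℕ.^ m)                      ≡⟨ ^-assocʳ (x + y) p (p ℕ.^ m) ⟨
    ((x + y) ^ p) ^ (p ℕ.^ m)                      ≡⟨ cong (_^ (p ℕ.^ m)) (^p-+ p-prime p×1≡0 x y) ⟩
    (x ^ p + y ^ p) ^ (p ℕ.^ m)                    ≡⟨ ^p^m-+ p-prime p×1≡0 m (x ^ p) (y ^ p) ⟩
    (x ^ p) ^ (p ℕ.^ m) + (y ^ p) ^ (p ℕ.^ m)      ≡⟨ cong₂ _+_ (^-assocʳ x p (p ℕ.^ m)) (^-assocʳ y p (p ℕ.^ m)) ⟩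
    x ^ (p ℕ.* p ℕ.^ m) + y ^ (p ℕ.* p ℕ.^ m)      ∎

-- Characteristic and Fermat's theorem in a finite field

module FiniteField (K : Field) {N : ℕ} (enum : Field.Carrier K ↔ Fin N) where
  open Field K using (Carrier; _+_; _*_; -_; 0#; 1#; 0≢1; inverse)
  open FieldProperties K
  open import Algebra.Properties.Semiring.Mult semiring using (×1-homo-*; ×-homo-1) renaming (_×_ to _·_)
  open import Algebra.Properties.CommutativeSemiring.Exp commutativeSemiring using (_^_)
  open import Algebra.Properties.Group +-group using (identityʳ-unique)
  import Algebra.Properties.CommutativeMonoid.Sum as Sum
  open FiniteSums +-commutativeMonoid using (sum-reindex)
  open FiniteSums *-commutativeMonoid using () renaming (sum-reindex to product-reindex)
  open Sum +-commutativeMonoid using (sum-replicate)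
  open Sum *-commutativeMonoid using ()
    renaming (sum to product; sum-cong-≗ to product-cong; sum-replicate to product-replicate;
              sum-replicate-zero to product-replicate-1; sum-remove to product-remove;
              ∑-distrib-+ to product-distrib-*)
  open Inverse enum using (to; from; strictlyInverseˡ; strictlyInverseʳ)

  infix 4 _≟_
  _≟_ : DecidableEquality Carrier
  _≟_ = via-injection (↔⇒↣ enum) Fin._≟_

  -- Translation by x permutes the field, so S = S + N · x for the sum S of all elements.
  N×x≡0 : ∀ x → N · x ≡ 0#
  N×x≡0 x = identityʳ-unique (sum from) (N · x) (begin
    sum from + N · x               ≡⟨ cong (sum from +_) (sum-replicate N) ⟨
    sum from + ∑[ i < N ] x        ≡⟨ ∑-distrib-+ from (λ _ → x) ⟨
    ∑[ i < N ] (from i + x)        ≡⟨ sum-reindex enum translation (λ y → y) ⟨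
    sum from                       ∎)
    where
    translation : Carrier ↔ Carrier
    translation = mk↔ₛ′ (_+ x) (_+ - x)
      (λ y → trans (+-assoc y (- x) x) (trans (cong (y +_) (-‿inverseˡ x)) (+-identityʳ y)))
      (λ y → trans (+-assoc y x (- x)) (trans (cong (y +_) (-‿inverseʳ x)) (+-identityʳ y)))

  -- The multiple p^k · 1 is zero and equals the k-th power of p · 1. In a field the factors can be
  -- cancelled one at a time; were none zero, 1 would be 0.
  characteristic : ∀ {p} k → N ≡ p ℕ.^ k → p · 1# ≡ 0#
  characteristic {p} k N≡p^k = go k (subst (λ n → n · 1# ≡ 0#) N≡p^k (N×x≡0 1#))
    where
    go : ∀ k → (p ℕ.^ k) · 1# ≡ 0# → p · 1# ≡ 0#
    go zero    1×1≡0 = contradiction (trans (sym 1×1≡0) (×-homo-1 1#)) 0≢1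
    go (suc k) p^[1+k]×1≡0 with p · 1# ≟ 0#
    ... | yes p×1≡0 = p×1≡0
    ... | no  p×1≢0 = go k (x*y≡0⇒y≡0 p×1≢0 (trans (sym (×1-homo-* p (p ℕ.^ k))) p^[1+k]×1≡0))

  product≢0 : ∀ {n} (f : Fin n → Carrier) → (∀ i → f i ≢ 0#) → product f ≢ 0#
  product≢0 {zero}  f f≢0 = 0≢1 ∘ sym
  product≢0 {suc n} f f≢0 = product≢0 (f ∘ suc) (f≢0 ∘ suc) ∘ x*y≡0⇒y≡0 (f≢0 zero)

  -- The element of `Fin n` certifies that n is positive, as the zeroth power of `0#` is `1#`.
  0^n≡0 : ∀ {n} → Fin n → 0# ^ n ≡ 0#
  0^n≡0 {suc n} _ = zeroˡ _

  product-single : ∀ {n} (i : Fin n) (f : Fin n → Carrier) → (∀ j → j ≢ i → f j ≡ 1#) → product f ≡ f i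
  product-single {suc n} i f f≡1 = begin
    product f                          ≡⟨ product-remove f ⟩
    f i * product (f ∘ punchIn i)      ≡⟨ cong (f i *_) (product-cong (λ j → f≡1 _ (Fin.punchInᵢ≢i i j))) ⟩
    f i * product {n} (λ _ → 1#)       ≡⟨ cong (f i *_) (product-replicate-1 n) ⟩
    f i * 1#                           ≡⟨ *-identityʳ (f i) ⟩
    f i                                ∎

  -- Multiplication by x permutes the nonzero elements. To multiply over the whole enumeration,
  -- unit replaces the element 0 by 1, and scale corrects x * unit y ≡ unit (x * y) at y = 0 only;
  -- multiplying over all y gives x ^ N * P ≡ P * x.
  x^N≡x : ∀ x → x ^ N ≡ x
  x^N≡x x with x ≟ 0#
  ... | yes refl = 0^n≡0 (to 0#)
  ... | no  x≢0  = begin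
    x ^ N                                     ≡⟨ product-replicate N ⟨
    product {N} (λ _ → x)                     ≡⟨ *-cancelˡ P≢0 (begin
      P * product {N} (λ _ → x)                 ≡⟨ *-comm P _ ⟩
      product {N} (λ _ → x) * P                 ≡⟨ product-distrib-* (λ _ → x) (unit ∘ from) ⟨
      product (λ i → x * unit (from i))         ≡⟨ product-cong (λ i → unit-scale (from i)) ⟩
      product (λ i → unit (x * from i) * scale (from i))
        ≡⟨ product-distrib-* (λ i → unit (x * from i)) (scale ∘ from) ⟩
      product (λ i → unit (x * from i)) * product (scale ∘ from)
        ≡⟨ cong (_* product (scale ∘ from)) (product-reindex enum multiplication unit) ⟨
      P * product (scale ∘ from)                ∎) ⟩
    product (scale ∘ from)                    ≡⟨ product-single (to 0#) (scale ∘ from) scale≢ ⟩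
    scale (from (to 0#))                      ≡⟨ cong scale (strictlyInverseʳ 0#) ⟩
    scale 0#                                  ≡⟨ scale-0 ⟩
    x                                         ∎
    where
    unit scale : Carrier → Carrier
    unit  y with y ≟ 0#
    ... | yes _ = 1#
    ... | no  _ = y
    scale y with y ≟ 0#
    ... | yes _ = x
    ... | no  _ = 1#

    scale-0 : scale 0# ≡ x
    scale-0 with 0# ≟ 0#
    ... | yes _   = refl
    ... | no  0≢0 = contradiction refl 0≢0

    scale≢ : ∀ i → i ≢ to 0# → scale (from i) ≡ 1#
    scale≢ i i≢to0 with from i ≟ 0#
    ... | yes eq = contradiction (trans (sym (strictlyInverseˡ i)) (cong to eq)) i≢to0
    ... | no  _  = refl

    unit≢0 : ∀ y → unit y ≢ 0#
    unit≢0 y with y ≟ 0#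
    ... | yes _   = 0≢1 ∘ sym
    ... | no  y≢0 = y≢0

    unit-scale : ∀ y → x * unit y ≡ unit (x * y) * scale y
    -- As x is nonzero, `y` and `x * y` vanish together, so the two mixed cases are contradictory.
    unit-scale y with y ≟ 0# | x * y ≟ 0#
    ... | yes _    | yes _    = *-comm x 1#
    ... | yes refl | no xy≢0  = contradiction (zeroʳ x) xy≢0
    ... | no y≢0   | yes xy≡0 = contradiction (x*y≡0⇒y≡0 x≢0 xy≡0) y≢0
    ... | no _     | no _     = sym (*-identityʳ (x * y))

    P : Carrier
    P = product (unit ∘ from)

    P≢0 : P ≢ 0#
    P≢0 = product≢0 _ (λ i → unit≢0 (from i))

    multiplication : Carrier ↔ Carrier
    multiplication = let x⁻¹ , xx⁻¹≡1 = inverse x x≢0 in mk↔ₛ′ (x *_) (x⁻¹ *_)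
      (λ y → trans (sym (*-assoc x x⁻¹ y)) (trans (cong (_* y) xx⁻¹≡1) (*-identityˡ y)))
      (λ y → trans (sym (*-assoc x⁻¹ x y))
                   (trans (cong (_* y) (trans (*-comm x⁻¹ x) xx⁻¹≡1)) (*-identityˡ y)))

-- Conjugation in the field with q² elements, and the conclusion

open import Data.Nat using (_*_; _^_)

theorem6p1 : (q n r N : ℕ) → IsPrimePower q → 1 ≤ n → 1 ≤ r →
    (K : Field) → (Field.Carrier K ↔ Fin (q ^ 2)) →
    LinAlg.PartialSpread K n r N →
    LinAlg.ConstRankDistHermitian K q n (2 * r) N
theorem6p1 q n r N (p , m , p-prime , _ , refl) _ 1≤r K enum =
  HermitianDifferences.partialSpread⇒constRankDist K _≟_ conj
    (record { σ-+ = conj-+ ; σ-* = conj-* ; σ-involutive = conj-involutive }) 1≤r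
  where
  open Field K using (Carrier; _+_)
  open FieldProperties K
  open FiniteField K enum
  open Frobenius K
  open import Algebra.Properties.CommutativeSemiring.Exp commutativeSemiring
    using (^-distrib-*; ^-assocʳ)

  conj : Carrier → Carrier
  conj x = Field._^_ K x q

  p^m^2≡p^[m*2] : (p ^ m) ^ 2 ≡ p ^ (m * 2)
  p^m^2≡p^[m*2] = ℕ.^-*-assoc p m 2

  -- As q = p^m, conjugation is an iterated Frobenius map. The characteristic is p because the field
  -- has p^(2m) elements.
  conj-+ : ∀ x y → conj (x + y) ≡ conj x + conj y
  conj-+ x y = trans (field-^≡^ (x + y) q)
    (trans (^p^m-+ p-prime (characteristic (m * 2) p^m^2≡p^[m*2]) m x y)
           (sym (cong₂ _+_ (field-^≡^ x q) (field-^≡^ y q))))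

  conj-* : ∀ x y → conj (Field._*_ K x y) ≡ Field._*_ K (conj x) (conj y)
  conj-* x y = trans (field-^≡^ _ q)
    (trans (^-distrib-* x y q) (sym (cong₂ (Field._*_ K) (field-^≡^ x q) (field-^≡^ y q))))

  -- Conjugating twice raises to the power q², the number of elements of the field, which fixes
  -- every element.
  conj-involutive : ∀ x → conj (conj x) ≡ x
  conj-involutive x = begin
    conj (conj x)  ≡⟨ trans (field-^≡^ (conj x) q) (cong (_^K q) (field-^≡^ x q)) ⟩
    (x ^K q) ^K q  ≡⟨ ^-assocʳ x q q ⟩
    -- `q ^ 2` computes to `q * (q * 1)`, hence the trailing factor 1.
    x ^K (q * q)   ≡⟨ cong (λ k → x ^K (q * k)) (ℕ.*-identityʳ q) ⟨
    x ^K (q ^ 2)   ≡⟨ x^N≡x x ⟩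
    x              ∎
    where open import Algebra.Properties.CommutativeSemiring.Exp commutativeSemiring
            using () renaming (_^_ to _^K_)
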